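{- Let $G=(V,E)$ be an undirected, unweighted graph with $n$ nodes and $m$ edges, let $E_g \subseteq E$ be a set of ``gray'' edges, let $s \in V$ be a source vertex, and let $g$ be a positive integer. Assign weight $w(u,v) = 1 + g^{ -1}$ to every gray edge and weight $w(u,v)=1$ to every non-gray edge, run Dijkstra's algorithm from $s$ with weight function $w$, and output the resulting paths $P(s,t)$ for each $t \in V$. This procedure runs in $O(m + n\log n)$ time, and for every $t \in V$ such that an $s \leadsto t$ g-short path exists, the output path $P(s,t)$ has at most $5g$ gray edges and satisfies $|P(s,t)| \leq |P_g(s,t)|$ for every $s \leadsto t$ path $P_g(s,t)$ with fewer than $g$ gray edges. That is, the procedure solves the weak constrained single-source shortest paths (weak CSSSP) problem.
   Context: An $s \leadsto t$ path is called g-short if it has fewer than $g$ gray edges and is of the form $(s,s') \circ \pi_G(s',t') \circ (t',t)$, where $\circ$ denotes path concatenation and $\pi_G(s',t')$ is a shortest $s'\leadsto t'$ path in $G$. $|P|$ denotes the number of edges of a path $P$. The weak CSSSP problem asks, given $G$, $E_g$, $s$, and $g$, for each $t\in V$ a path $P(s,t)$ on at most $5g$ gray edges such that, whenever an $s\leadsto t$ g-short path exists, $|P(s,t)| \le |P_g(s,t)|$ for all $s\leadsto t$ paths $P_g(s,t)$ on fewer than $g$ gray edges (if no g-short path exists, $P(s,t)$ may be arbitrary). Dijkstra's algorithm is assumed implemented with Fibonacci heaps. -}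

module Defs where

open import Data.Bool using (if_then_else_)
open import Data.Fin using (Fin; _≟_)
open import Data.Fin.Subset using (Subset)
open import Data.Fin.Subset.Properties using (_∈?_)
open import Data.Integer using (+_)
open import Data.List using (List; []; _∷_; allFin)
open import Data.List.Relation.Unary.Unique.Propositional using (Unique)
open import Data.Maybe using (Maybe; just; nothing; map; maybe′)
open import Data.Nat using (ℕ; zero; suc; _+_; _*_; _≤_; _<_; NonZero)
open import Data.Nat.Logarithm using (⌊log₂_⌋)
open import Data.Product using (_×_; _,_; proj₁; proj₂; ∃-syntax)
open import Data.Rational as ℚ using (ℚ; 0ℚ; 1ℚ; _/_)
open import Data.Sum using (_⊎_; inj₁; inj₂)
open import Relation.Binary.PropositionalEquality using (_≡_; _≢_; refl; _≗_)
open import Relation.Nullary using (yes; no; does)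

------------------------------------------------------------------------
-- Graphs and walks

-- Undirected simple graphs on Fin n with edge set Fin m.  The order of the
-- two endpoints of an edge carries no meaning; see Joins.

record Graph (n m : ℕ) : Set where
  field
    endpoints : Fin m → Fin n × Fin n

  Joins : Fin m → Fin n → Fin n → Set
  Joins e u v = endpoints e ≡ (u , v) ⊎ endpoints e ≡ (v , u)

  field
    loopless   : ∀ e → proj₁ (endpoints e) ≢ proj₂ (endpoints e)
    noParallel : ∀ {e f u v} → Joins e u v → Joins f u v → e ≡ f

module Walks {n m : ℕ} (G : Graph n m) where
  open Graph G

  record Arc (u v : Fin n) : Set where
    constructor _along_
    field
      edge  : Fin m
      joins : Joins edge u v

  open Arc public

  infixl 5 _▷_ _++_

  -- Walks grow at the far end, so that p ▷ a shares p: an array of walks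
  -- from s stands for a predecessor tree rooted at s.
  data Walk (u : Fin n) : Fin n → Set where
    []  : Walk u u
    _▷_ : ∀ {v w} → Walk u v → Arc v w → Walk u w

  _++_ : ∀ {u v w} → Walk u v → Walk v w → Walk u w
  p ++ []      = p
  p ++ (q ▷ a) = (p ++ q) ▷ a

  ∣_∣ : ∀ {u v} → Walk u v → ℕ
  ∣ []    ∣ = 0
  ∣ p ▷ _ ∣ = suc ∣ p ∣

  gray : Subset m → ∀ {u v} → Walk u v → ℕ
  gray Eg []      = 0
  gray Eg (p ▷ a) = (if does (edge a ∈? Eg) then 1 else 0) + gray Eg p

  -- In reverse order.
  vertices : ∀ {u v} → Walk u v → List (Fin n)
  vertices {v = v} []      = v ∷ []
  vertices {v = v} (p ▷ _) = v ∷ vertices p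

  Simple : ∀ {u v} → Walk u v → Set
  Simple p = Unique (vertices p)

  Shortest : ∀ {u v} → Walk u v → Set
  Shortest {u} {v} p = ∀ (q : Walk u v) → ∣ p ∣ ≤ ∣ q ∣

  GShort : Subset m → ℕ → ∀ {s t} → Walk s t → Set
  GShort Eg g {s} {t} p =
    gray Eg p < g ×
    ∃[ s′ ] ∃[ t′ ] ∃[ a ] ∃[ π ] ∃[ b ]
      Shortest {s′} {t′} π × p ≡ ([] {s} ▷ a) ++ π ++ ([] {t′} ▷ b)

  -- One walk from s for each vertex, or nothing where none is provided.
  Solution : Fin n → Set
  Solution s = ∀ t → Maybe (Walk s t)

  -- Competing walks may repeat vertices; the returned one may not.
  SolvesWeakCSSSP : Subset m → (s : Fin n) → ℕ → Solution s → Set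
  SolvesWeakCSSSP Eg s g P =
    ∀ t → (∃[ q ] GShort Eg g {s} {t} q) →
    ∃[ p ] P t ≡ just p × Simple p × gray Eg p ≤ 5 * g ×
           (∀ (q : Walk s t) → gray Eg q < g → ∣ p ∣ ≤ ∣ q ∣)

------------------------------------------------------------------------
-- Running time

-- Results paired with the number of unit-cost operations spent on them:
-- array accesses, loop iterations and arithmetic on edge weights.

record Timed (A : Set) : Set where
  constructor _after_
  field
    value : A
    time  : ℕ

open Timed public

infixl 1 _>>=_

_>>=_ : ∀ {A B} → Timed A → (A → Timed B) → Timed B
value (x >>= f) = value (f (value x))
time  (x >>= f) = time x + time (f (value x))

free : ∀ {A} → A → Timed A
free x = x after 0

unit : ∀ {A} → A → Timed A
unit x = x after 1

forEach : ∀ {A S : Set} → List A → (A → S → Timed S) → S → Timed S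
forEach []       f σ = free σ
forEach (x ∷ xs) f σ = do
  σ ← unit σ
  σ ← f x σ
  forEach xs f σ

Array : ∀ {n} → (Fin n → Set) → Set
Array B = ∀ i → B i

infixl 6 _[_≔_]

_[_≔_] : ∀ {n} {B : Fin n → Set} → Array B → (i : Fin n) → B i → Array B
(xs [ i ≔ x ]) j with i ≟ j
... | yes refl = x
... | no  _    = xs j

newArray : ∀ {n} {B : Fin n → Set} → (∀ i → B i) → Timed (Array B)
newArray {n} xs = xs after n

read : ∀ {n} {B : Fin n → Set} → Array B → (i : Fin n) → Timed (B i)
read xs i = unit (xs i)

write : ∀ {n} {B : Fin n → Set} → Array B → (i : Fin n) → B i → Timed (Array B)
write xs i x = unit (xs [ i ≔ x ])

------------------------------------------------------------------------
-- Fibonacci heaps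

-- Priority queues with the amortised costs of Fibonacci heaps, as witnessed
-- by a potential Φ.  A heap of type Heap n holds distinct items from Fin n,
-- and an item serves as its own handle; make may take linear time to set
-- up the table of nodes.  Nothing is demanded of insert on an item already
-- present, or of decreaseKey on an absent item or with a larger key.

record FibonacciHeap : Set₁ where
  field
    Heap        : ℕ → Set
    make        : ∀ n → Timed (Heap n)
    insert      : ∀ {n} → Fin n → ℚ → Heap n → Timed (Heap n)
    decreaseKey : ∀ {n} → Fin n → ℚ → Heap n → Timed (Heap n)
    deleteMin   : ∀ {n} → Heap n → Timed (Maybe (Fin n × Heap n))

    key : ∀ {n} → Heap n → Fin n → Maybe ℚ

    key-make : ∀ n i → key (value (make n)) i ≡ nothing
    key-insert : ∀ {n} (h : Heap n) i k → key h i ≡ nothing →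
      key (value (insert i k h)) ≗ key h [ i ≔ just k ]
    key-decreaseKey : ∀ {n} (h : Heap n) i {k k′} → key h i ≡ just k → k′ ℚ.≤ k →
      key (value (decreaseKey i k′ h)) ≗ key h [ i ≔ just k′ ]
    deleteMin-nothing : ∀ {n} (h : Heap n) → value (deleteMin h) ≡ nothing →
      ∀ i → key h i ≡ nothing
    deleteMin-just : ∀ {n} (h : Heap n) {i h′} → value (deleteMin h) ≡ just (i , h′) →
      (∃[ k ] key h i ≡ just k × (∀ j {l} → key h j ≡ just l → k ℚ.≤ l)) ×
      key h′ ≗ key h [ i ≔ nothing ]

    Φ : ∀ {n} → Heap n → ℕ
    C : ℕ

    make-cost : ∀ n → time (make n) + Φ (value (make n)) ≤ C * suc n
    insert-cost : ∀ {n} (h : Heap n) i k → key h i ≡ nothing →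
      time (insert i k h) + Φ (value (insert i k h)) ≤ C + Φ h
    decreaseKey-cost : ∀ {n} (h : Heap n) i {k k′} → key h i ≡ just k → k′ ℚ.≤ k →
      time (decreaseKey i k′ h) + Φ (value (decreaseKey i k′ h)) ≤ C + Φ h
    deleteMin-cost : ∀ {n} (h : Heap n) →
      time (deleteMin h) + maybe′ (λ (_ , h′) → Φ h′) 0 (value (deleteMin h))
        ≤ C * suc ⌊log₂ n ⌋ + Φ h

------------------------------------------------------------------------
-- Dijkstra's algorithm

module Algorithm (H : FibonacciHeap) {n m : ℕ} (G : Graph n m) where
  open FibonacciHeap H using (Heap; make; insert; decreaseKey; deleteMin)
  open Graph G
  open Walks G

  AdjacencyLists : Set
  AdjacencyLists = Array {n} (λ u → List (∃[ v ] Arc u v))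

  addEdge : Fin m → AdjacencyLists → Timed AdjacencyLists
  addEdge e adj = do
    let (u , v) = endpoints e
    as  ← read adj u
    adj ← write adj u ((v , (e along inj₁ refl)) ∷ as)
    bs  ← read adj v
    write adj v ((u , (e along inj₂ refl)) ∷ bs)

  adjacencyLists : Timed AdjacencyLists
  adjacencyLists = do
    adj ← newArray (λ _ → [])
    forEach (allFin m) addEdge adj

  module _ (w : Fin m → ℚ) (s : Fin n) where

    -- Tentative distance and the walk realising it; nothing stands for ∞.
    Label : Fin n → Set
    Label v = Maybe (ℚ × Walk s v)

    State : Set
    State = Array Label × Heap n

    update : ∀ v → ℚ → Walk s v → Maybe (ℚ × Walk s v) → State → Timed State
    update v d p nothing (labels , heap) = do
      labels ← write labels v (just (d , p))
      heap   ← insert v d heap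
      free (labels , heap)
    update v d p (just (d′ , _)) (labels , heap) = do
      closer ← unit (does (d ℚ.<? d′))
      if closer
        then (do
          labels ← write labels v (just (d , p))
          heap   ← decreaseKey v d heap
          free (labels , heap))
        else free (labels , heap)

    relax : ∀ {u} → ℚ → Walk s u → ∃[ v ] Arc u v → State → Timed State
    relax d p (v , a) (labels , heap) = do
      d′    ← unit (d ℚ.+ w (edge a))
      label ← read labels v
      update v d′ (p ▷ a) label (labels , heap)

    settle : AdjacencyLists → Array Label → Fin n × Heap n → Timed State
    settle adj labels (u , heap) = do
      label ← read labels u
      arcs  ← read adj u
      maybe′ (λ (d , p) → forEach arcs (relax d p)) free label (labels , heap)

    -- Every vertex leaves the heap at most once, so n rounds suffice.
    rounds : AdjacencyLists → ℕ → State → Timed (Array Label)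
    rounds adj zero    (labels , heap) = free labels
    rounds adj (suc k) (labels , heap) = do
      min ← deleteMin heap
      min ← unit min
      maybe′ (λ uh → settle adj labels uh >>= rounds adj k) (free labels) min

    dijkstra : Timed (Solution s)
    dijkstra = do
      adj    ← adjacencyLists
      labels ← newArray (λ _ → nothing)
      labels ← write labels s (just (0ℚ , []))
      heap   ← make n
      heap   ← insert s 0ℚ heap
      labels ← rounds adj n (labels , heap)
      newArray (λ t → map proj₂ (labels t))

grayWeight : ∀ {m} → Subset m → (g : ℕ) .{{_ : NonZero g}} → Fin m → ℚ
grayWeight Eg g e = if does (e ∈? Eg) then 1ℚ ℚ.+ (+ 1 / g) else 1ℚ

weakCSSSP : FibonacciHeap → ∀ {n m} (G : Graph n m) → Subset m →
  (s : Fin n) (g : ℕ) .{{_ : NonZero g}} → Timed (Walks.Solution G s)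
weakCSSSP H G Eg s g = Algorithm.dijkstra H G (grayWeight Eg g) s

{-# OPTIONS --safe #-}
module Submission where

-- Scaled by g, the weight of a walk p is g ∣ p ∣ + gray p.  Dijkstra's algorithm returns a walk p to t of
-- minimal weight, which is simple because all weights are positive.  If q also leads to t and has fewer than
-- g gray edges, then g ∣ p ∣ + gray p < g (∣ q ∣ + 1), so ∣ p ∣ ≤ ∣ q ∣.  If q is moreover g-short, then
-- ∣ q ∣ ≤ 4 + ∣ p ∣, because its middle part is shortest, and hence gray p < 5 g.
--
-- For the running time, the potential of the heap is complemented by the degrees of the unsettled vertices:
-- each arc is relaxed only when its tail is settled, and the degrees sum to 2 m.

open import Defs
import Algebra.Properties.CommutativeMonoid.Sum as Sum
open import Data.Bool using (Bool; true; false; if_then_else_)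
open import Data.Bool.Properties using (¬-not)
open import Data.Fin using (Fin; _≟_; punchIn)
open import Data.Fin.Properties using (punchInᵢ≢i)
open import Data.Fin.Subset using (Subset)
open import Data.Fin.Subset.Properties using (_∈?_)
import Data.Integer as ℤ
import Data.Integer.Properties as ℤₚ
open import Data.List using (List; []; _∷_; length; allFin)
open import Data.List.Membership.Propositional using (_∈_)
open import Data.List.Membership.Propositional.Properties using (∈-allFin)
open import Data.List.Properties using (length-tabulate)
open import Data.List.Relation.Unary.All as All using (All; []; _∷_)
open import Data.List.Relation.Unary.AllPairs using ([]; _∷_)
open import Data.List.Relation.Unary.All.Properties using (¬Any⇒All¬)
open import Data.List.Relation.Unary.Any using (here; there)
open import Data.Maybe using (Maybe; just; nothing; map)
open import Data.Nat using (ℕ; zero; suc; _+_; _*_; _≤_; _<_; z≤n; s≤s; NonZero; >-nonZero⁻¹)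
open import Data.Nat.Logarithm using (⌊log₂_⌋; ⌊log₂⌋-mono-≤)
open import Data.Nat.Properties hiding (_≟_)
open import Data.Nat.Tactic.RingSolver using (solve-∀)
open import Data.Integer.Tactic.RingSolver using () renaming (solve-∀ to ℤ-solve-∀)
open import Data.Product using (_×_; _,_; proj₁; proj₂; ∃-syntax)
open import Data.Rational as ℚ using (ℚ; 0ℚ; 1ℚ)
import Data.Rational.Properties as ℚₚ
import Data.Rational.Unnormalised as ℚᵘ
import Data.Rational.Unnormalised.Properties as ℚᵘₚ
open import Data.Sum using (inj₁; inj₂; swap)
open import Function using (_∘_)
open import Relation.Binary.PropositionalEquality
open import Relation.Nullary.Decidable using (dec-true; dec-false)
open import Relation.Nullary using (¬_; yes; no; does; contradiction)

open Sum +-0-commutativeMonoid using (sum; sum-remove; sum-cong-≗)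

-- Arrays and sums over Fin n

≔-same : ∀ {n} {B : Fin n → Set} (xs : Array B) i {x} → (xs [ i ≔ x ]) i ≡ x
≔-same xs i with i ≟ i
... | yes refl = refl
... | no  i≢i  = contradiction refl i≢i

≔-other : ∀ {n} {B : Fin n → Set} (xs : Array B) {i j x} → i ≢ j → (xs [ i ≔ x ]) j ≡ xs j
≔-other xs {i} {j} i≢j with i ≟ j
... | yes i≡j = contradiction i≡j i≢j
... | no  _   = refl

-- Adding the differing entry on both sides avoids truncated subtraction.
sum-agreeOff : ∀ {n} {f h : Fin n → ℕ} i → (∀ j → i ≢ j → f j ≡ h j) → sum f + h i ≡ sum h + f i
sum-agreeOff {suc n} {f} {h} i agree = begin
  sum f + h i          ≡⟨ cong (_+ h i) (sum-remove {i = i} f) ⟩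
  f i + rest f + h i   ≡⟨ cong (λ r → f i + r + h i) (sum-cong-≗ λ j → agree (punchIn i j) (punchInᵢ≢i i j ∘ sym)) ⟩
  f i + rest h + h i   ≡⟨ shuffle (f i) (rest h) (h i) ⟩
  h i + rest h + f i   ≡⟨ cong (_+ f i) (sum-remove {i = i} h) ⟨
  sum h + f i          ∎
  where
  open ≡-Reasoning
  rest : (Fin (suc n) → ℕ) → ℕ
  rest f = sum (λ j → f (punchIn i j))
  shuffle : ∀ a b c → a + b + c ≡ c + b + a
  shuffle = solve-∀

≤-sum : ∀ {n} (f : Fin n → ℕ) i → f i ≤ sum f
≤-sum {suc n} f i = subst (f i ≤_) (sym (sum-remove {i = i} f)) (m≤m+n (f i) _)

sum-const : ∀ n c → sum {n} (λ _ → c) ≡ n * c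
sum-const zero    c = refl
sum-const (suc n) c = cong (c +_) (sum-const n c)

-- The share of `f` outside `S`. For `f` constantly 1 its sum is the number of rounds still to run;
-- for `f` the degree it is the number of arcs still to relax.
pending : ∀ {n} → (Fin n → Bool) → (Fin n → ℕ) → Fin n → ℕ
pending S f v = if S v then 0 else f v

sum-pending : ∀ {n} {S : Fin n → Bool} (f : Fin n → ℕ) {u} → S u ≡ false →
  sum (pending S f) ≡ f u + sum (pending (S [ u ≔ true ]) f)
sum-pending {S = S} f {u} u∉S = begin
  sum (pending S f)                  ≡⟨ +-identityʳ _ ⟨
  sum (pending S f) + 0              ≡⟨ cong (λ b → sum (pending S f) + (if b then 0 else f u)) (≔-same S u) ⟨
  sum (pending S f) + pending S′ f u ≡⟨ sum-agreeOff {f = pending S f} u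
                                          (λ v u≢v → cong (λ b → if b then 0 else f v) (sym (≔-other S u≢v))) ⟩
  sum (pending S′ f) + pending S f u ≡⟨ cong (λ b → sum (pending S′ f) + (if b then 0 else f u)) u∉S ⟩
  sum (pending S′ f) + f u           ≡⟨ +-comm _ (f u) ⟩
  f u + sum (pending S′ f)           ∎
  where
  open ≡-Reasoning
  S′ = S [ u ≔ true ]

-- Weighted walks

module Weighted {n m : ℕ} (G : Graph n m) (w : Fin m → ℚ) (0<w : ∀ e → 0ℚ ℚ.< w e) where
  open Walks G

  weight : ∀ {u v} → Walk u v → ℚ
  weight []      = 0ℚ
  weight (p ▷ a) = weight p ℚ.+ w (edge a)

  Minimal : ∀ {u v} → Walk u v → Set
  Minimal {u} {v} p = ∀ (q : Walk u v) → weight p ℚ.≤ weight q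

  <-+-w : ∀ d e → d ℚ.< d ℚ.+ w e
  <-+-w d e = subst (ℚ._< d ℚ.+ w e) (ℚₚ.+-identityʳ d) (ℚₚ.+-monoʳ-< d (0<w e))

  -- Cut `p` at an occurrence of `x`; the arcs dropped have positive weight.
  prefix : ∀ {u v x} (p : Walk u v) → x ∈ vertices p → ∃[ q ] weight {u} {x} q ℚ.≤ weight p
  prefix []      (here refl) = [] , ℚₚ.≤-refl
  prefix (p ▷ a) (here refl) = p ▷ a , ℚₚ.≤-refl
  prefix (p ▷ a) (there x∈p) =
    let q , q≤p = prefix p x∈p
    in q , ℚₚ.≤-trans q≤p (ℚₚ.<⇒≤ (<-+-w (weight p) (edge a)))

  minimal-init : ∀ {u v x} (p : Walk u v) (a : Arc v x) → Minimal (p ▷ a) → Minimal p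
  minimal-init p a min q =
    ℚₚ.≮⇒≥ λ q<p → ℚₚ.<-irrefl refl (ℚₚ.<-≤-trans (ℚₚ.+-monoˡ-< (w (edge a)) q<p) (min (q ▷ a)))

  -- If the endpoint occurred earlier, stopping there would save at least the positive weight of the
  -- last arc.
  minimal⇒simple : ∀ {u v} (p : Walk u v) → Minimal p → Simple p
  minimal⇒simple []      min = [] ∷ []
  minimal⇒simple (p ▷ a) min = ¬Any⇒All¬ _ end∉p ∷ minimal⇒simple p (minimal-init p a min)
    where
    end∉p : ¬ (_ ∈ vertices p)
    end∉p end∈p =
      let q , q≤p = prefix p end∈p
      in ℚₚ.<-irrefl refl (ℚₚ.<-≤-trans (<-+-w (weight p) (edge a)) (ℚₚ.≤-trans (min q) q≤p))

-- Adjacency lists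

module Adjacency (H : FibonacciHeap) {n m : ℕ} (G : Graph n m) where
  open Graph G
  open Walks G
  open Algorithm H G

  degree : AdjacencyLists → Fin n → ℕ
  degree adj u = length (adj u)

  Lists : AdjacencyLists → Fin m → Set
  Lists adj e = ∀ {u v} (j : Joins e u v) → (v , (e along j)) ∈ adj u

  push : AdjacencyLists → ∀ u → ∃[ v ] Arc u v → AdjacencyLists
  push adj u x = adj [ u ≔ x ∷ adj u ]

  sum-push : ∀ adj u x → sum (degree (push adj u x)) ≡ suc (sum (degree adj))
  sum-push adj u x = +-cancelʳ-≡ (degree adj u) _ _ (begin
    sum (degree adj′) + degree adj u   ≡⟨ sum-agreeOff {f = degree adj′} u (λ v u≢v → cong length (≔-other adj u≢v)) ⟩
    sum (degree adj) + degree adj′ u   ≡⟨ cong (λ l → sum (degree adj) + length l) (≔-same adj u) ⟩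
    sum (degree adj) + suc (degree adj u) ≡⟨ +-suc _ _ ⟩
    suc (sum (degree adj)) + degree adj u ∎)
    where
    open ≡-Reasoning
    adj′ = push adj u x

  ∈-push : ∀ adj u x → x ∈ push adj u x u
  ∈-push adj u x = subst (x ∈_) (sym (≔-same adj u)) (here refl)

  push-⊇ : ∀ adj u x {v y} → y ∈ adj v → y ∈ push adj u x v
  push-⊇ adj u x {v} y∈adj with u ≟ v
  ... | yes refl = there y∈adj
  ... | no  _    = y∈adj

  forward : ∀ e → ∃[ v ] Arc (proj₁ (endpoints e)) v
  forward e = _ , (e along inj₁ refl)

  backward : ∀ e → ∃[ v ] Arc (proj₂ (endpoints e)) v
  backward e = _ , (e along inj₂ refl)

  pushForward : Fin m → AdjacencyLists → AdjacencyLists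
  pushForward e adj = push adj _ (forward e)

  -- A proof of `Joins` is `inj₁ refl` or `inj₂ refl`, and these give exactly the two arcs that
  -- `addEdge` pushes. The forward arc goes in first and has to survive the second push.
  addEdge-lists : ∀ e adj → Lists (value (addEdge e adj)) e
  addEdge-lists e adj (inj₁ refl) = push-⊇ (pushForward e adj) _ (backward e) (∈-push adj _ (forward e))
  addEdge-lists e adj (inj₂ refl) = ∈-push (pushForward e adj) _ (backward e)

  addEdge-⊇ : ∀ e adj {u x} → x ∈ adj u → x ∈ value (addEdge e adj) u
  addEdge-⊇ e adj x∈adj = push-⊇ (pushForward e adj) _ (backward e) (push-⊇ adj _ (forward e) x∈adj)

  addEdge-sum : ∀ e adj → sum (degree (value (addEdge e adj))) ≡ 2 + sum (degree adj)
  addEdge-sum e adj = trans (sum-push (pushForward e adj) _ (backward e)) (cong suc (sum-push adj _ (forward e)))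

  addEdges-⊇ : ∀ es adj {u x} → x ∈ adj u → x ∈ value (forEach es addEdge adj) u
  addEdges-⊇ []       adj x∈adj = x∈adj
  addEdges-⊇ (e ∷ es) adj x∈adj = addEdges-⊇ es _ (addEdge-⊇ e adj x∈adj)

  addEdges-lists : ∀ {es e} adj → e ∈ es → Lists (value (forEach es addEdge adj)) e
  addEdges-lists {e ∷ es} adj (here refl)  j = addEdges-⊇ es _ (addEdge-lists e adj j)
  addEdges-lists {e ∷ es} adj (there e∈es) j = addEdges-lists {es} _ e∈es j

  addEdges-sum : ∀ es adj → sum (degree (value (forEach es addEdge adj))) ≡ length es * 2 + sum (degree adj)
  addEdges-sum []       adj = refl
  addEdges-sum (e ∷ es) adj = begin
    _                                                   ≡⟨ addEdges-sum es _ ⟩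
    length es * 2 + sum (degree (value (addEdge e adj))) ≡⟨ cong (length es * 2 +_) (addEdge-sum e adj) ⟩
    length es * 2 + (2 + sum (degree adj))               ≡⟨ shuffle (length es) (sum (degree adj)) ⟩
    2 + length es * 2 + sum (degree adj)                 ∎
    where
    open ≡-Reasoning
    shuffle : ∀ l d → l * 2 + (2 + d) ≡ 2 + l * 2 + d
    shuffle = solve-∀

  addEdges-time : ∀ es adj → time (forEach es addEdge adj) ≡ length es * 5
  addEdges-time []       adj = refl
  -- Two reads, two writes and one loop iteration.
  addEdges-time (e ∷ es) adj = cong (5 +_) (addEdges-time es _)

  Complete : AdjacencyLists → Set
  Complete adj = ∀ {u v} (a : Arc u v) → (v , a) ∈ adj u

  adjacency-complete : Complete (value adjacencyLists)
  adjacency-complete (e along j) = addEdges-lists (λ _ → []) (∈-allFin e) j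

  length-allFin : length (allFin m) ≡ m
  length-allFin = length-tabulate (λ i → i)

  -- The handshake identity.
  sum-degree : sum (degree (value adjacencyLists)) ≡ m * 2
  sum-degree = begin
    sum (degree (value adjacencyLists))       ≡⟨ addEdges-sum (allFin m) (λ _ → []) ⟩
    length (allFin m) * 2 + sum {n} (λ _ → 0) ≡⟨ cong₂ (λ l z → l * 2 + z) length-allFin (trans (sum-const n 0) (*-zeroʳ n)) ⟩
    m * 2 + 0                                 ≡⟨ +-identityʳ _ ⟩
    m * 2                                     ∎
    where open ≡-Reasoning

  adjacencyLists-time : time adjacencyLists ≡ n + m * 5
  adjacencyLists-time = cong (n +_) (trans (addEdges-time (allFin m) _) (cong (_* 5) length-allFin))

-- Dijkstra's algorithm

module Dijkstra (H : FibonacciHeap) {n m : ℕ} (G : Graph n m)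
                (w : Fin m → ℚ) (0<w : ∀ e → 0ℚ ℚ.< w e) (s : Fin n) where
  open FibonacciHeap H
  open Walks G
  open Algorithm H G
  open Weighted G w 0<w
  open Adjacency H G

  -- Labels and the invariant

  Labels : Set
  Labels = Array (Label w s)

  -- An upper bound on the label rather than its value, so that the property survives every later
  -- decrease.
  Reached : Labels → Fin n → ℚ → Set
  Reached labels v x = ∃[ d ] ∃[ p ] labels v ≡ just (d , p) × d ℚ.≤ x

  Relaxed : Labels → ℚ → ∀ {u} → ∃[ v ] Arc u v → Set
  Relaxed labels d (v , a) = Reached labels v (d ℚ.+ w (edge a))

  -- S is the set of vertices that have left the heap, and D the last key to leave it.
  record Invariant (S : Fin n → Bool) (D : ℚ) (σ : State w s) : Set where
    field
      keys     : ∀ v → key (proj₂ σ) v ≡ (if S v then nothing else map proj₁ (proj₁ σ v))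
      weighed  : ∀ {v d p} → proj₁ σ v ≡ just (d , p) → d ≡ weight p
      settled≤ : ∀ {v} → S v ≡ true → Reached (proj₁ σ) v D
      ≤queued  : ∀ {v k} → key (proj₂ σ) v ≡ just k → D ℚ.≤ k

    queued : ∀ {v l} → S v ≡ false → proj₁ σ v ≡ l → key (proj₂ σ) v ≡ map proj₁ l
    queued v∉S v↦l = trans (keys _) (cong₂ (λ b l → if b then nothing else map proj₁ l) v∉S v↦l)

  open Invariant

  -- What relaxing arcs does while `S` and `D` stay fixed. It composes, so a list of arcs can be
  -- handled one arc at a time.
  record Improves (S : Fin n → Bool) (D : ℚ) (σ σ′ : State w s) : Set where
    field
      invariant : Invariant S D σ′
      keep      : ∀ {v} → S v ≡ true → proj₁ σ′ v ≡ proj₁ σ v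
      lower     : ∀ {v x} → Reached (proj₁ σ) v x → Reached (proj₁ σ′) v x

  open Improves

  improves-refl : ∀ {S D σ} → Invariant S D σ → Improves S D σ σ
  improves-refl inv = record { invariant = inv ; keep = λ _ → refl ; lower = λ r → r }

  improves-trans : ∀ {S D σ σ′ σ″} → Improves S D σ σ′ → Improves S D σ′ σ″ → Improves S D σ σ″
  improves-trans i j = record
    { invariant = invariant j
    ; keep      = λ v∈S → trans (keep j v∈S) (keep i v∈S)
    ; lower     = λ r → lower j (lower i r)
    }

  -- The common core of inserting a vertex, decreasing its key and starting at the source: each
  -- gives an unsettled vertex the same new value as label and as key.
  relabel : ∀ {S D labels heap heap′ v d} {p : Walk s v} → Invariant S D (labels , heap) →
    S v ≡ false → D ℚ.≤ d → d ≡ weight p → (∀ {x} → Reached labels v x → d ℚ.≤ x) →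
    key heap′ ≗ key heap [ v ≔ just d ] →
    Improves S D (labels , heap) (labels [ v ≔ just (d , p) ] , heap′)
  relabel {S} {D} {labels} {heap} {heap′} {v} {d} {p} inv v∉S D≤d d≡p d≤ key′ = record
    { invariant = record { keys = keys′ ; weighed = weighed′ ; settled≤ = lower′ ∘ settled≤ inv ; ≤queued = ≤queued′ }
    ; keep      = keep′
    ; lower     = lower′
    }
    where
    labels′ : Labels
    labels′ = labels [ v ≔ just (d , p) ]

    keys′ : ∀ u → key heap′ u ≡ (if S u then nothing else map proj₁ (labels′ u))
    keys′ u with v ≟ u | key′ u
    ... | yes refl | key≡ = trans key≡ (cong (λ b → if b then nothing else just d) (sym v∉S))
    ... | no  _    | key≡ = trans key≡ (keys inv u)

    weighed′ : ∀ {u e q} → labels′ u ≡ just (e , q) → e ≡ weight q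
    weighed′ {u} u↦ with v ≟ u
    weighed′ refl | yes refl = d≡p
    weighed′ u↦   | no  _    = weighed inv u↦

    ≤queued′ : ∀ {u k} → key heap′ u ≡ just k → D ℚ.≤ k
    ≤queued′ {u} u↦ with v ≟ u | trans (sym (key′ u)) u↦
    ... | yes refl | refl = D≤d
    ... | no  _    | key≡ = ≤queued inv key≡

    keep′ : ∀ {u} → S u ≡ true → labels′ u ≡ labels u
    keep′ {u} u∈S with v ≟ u
    ... | yes refl = contradiction (trans (sym u∈S) v∉S) λ ()
    ... | no  _    = refl

    lower′ : ∀ {u x} → Reached labels u x → Reached labels′ u x
    lower′ {u} r with v ≟ u
    ... | yes refl = d , p , refl , d≤ r
    ... | no  _    = r

  -- Relaxing arcs

  reached-unique : ∀ labels {v d p x} → labels v ≡ just (d , p) → Reached labels v x → d ℚ.≤ x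
  reached-unique labels v↦ (_ , _ , v↦′ , d≤x) with trans (sym v↦) v↦′
  ... | refl = d≤x

  -- The 2 in the cost covers the comparison of distances and the write of the label; `C` pays for
  -- the heap operation.
  update-improves : ∀ {S D labels heap v d p} → Invariant S D (labels , heap) →
    D ℚ.≤ d → d ≡ weight p → ∀ {l} → labels v ≡ l →
    let r = update w s v d p l (labels , heap) in
    Improves S D (labels , heap) (value r) × Reached (proj₁ (value r)) v d ×
    time r + Φ (proj₂ (value r)) ≤ 2 + C + Φ heap
  update-improves {S} {D} {labels} {heap} {v} {d} {p} inv D≤d d≡p {nothing} v↦ =
    relabel inv v∉S D≤d d≡p (λ r → contradiction r unreached) (key-insert heap v d v∉heap) ,
    (d , p , ≔-same labels v , ℚₚ.≤-refl) ,
    s≤s (m≤n⇒m≤1+n (subst (λ t → t + Φ (value (insert v d heap)) ≤ C + Φ heap) (sym (+-identityʳ _))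
      (insert-cost heap v d v∉heap)))
    where
    unreached : ∀ {x} → ¬ Reached labels v x
    unreached (_ , _ , v↦′ , _) = contradiction (trans (sym v↦) v↦′) λ ()
    v∉S : S v ≡ false
    v∉S = ¬-not (unreached ∘ settled≤ inv)
    v∉heap : key heap v ≡ nothing
    v∉heap = queued inv v∉S v↦
  update-improves {S} {D} {labels} {heap} {v} {d} {p} inv D≤d d≡p {just (d′ , p′)} v↦ with d ℚ.<? d′
  ... | no d≮d′ rewrite dec-false (d ℚ.<? d′) d≮d′ = improves-refl inv , (d′ , p′ , v↦ , ℚₚ.≮⇒≥ d≮d′) , s≤s (m≤n+m _ (1 + C))
  ... | yes d<d′ rewrite dec-true (d ℚ.<? d′) d<d′ =
    relabel inv v∉S D≤d d≡p (λ r → ℚₚ.≤-trans (ℚₚ.<⇒≤ d<d′) (reached-unique labels v↦ r))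
      (key-decreaseKey heap v v∈heap (ℚₚ.<⇒≤ d<d′)) ,
    (d , p , ≔-same labels v , ℚₚ.≤-refl) ,
    s≤s (s≤s (subst (λ t → t + Φ (value (decreaseKey v d heap)) ≤ C + Φ heap) (sym (+-identityʳ _))
      (decreaseKey-cost heap v v∈heap (ℚₚ.<⇒≤ d<d′))))
    where
    -- Settled labels are at most D, so no later candidate is closer.
    v∉S : S v ≡ false
    v∉S = ¬-not λ v∈S → ℚₚ.<-irrefl refl
      (ℚₚ.<-≤-trans d<d′ (ℚₚ.≤-trans (reached-unique labels v↦ (settled≤ inv v∈S)) D≤d))
    v∈heap : key heap v ≡ just d′
    v∈heap = queued inv v∉S v↦

  -- Positive weights keep the candidate distance above `D`, as `update-improves` demands. Two
  -- further units pay for the addition and for reading the label.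
  relax-improves : ∀ {S D σ u} {p : Walk s u} → Invariant S D σ → D ≡ weight p → (x : ∃[ v ] Arc u v) →
    let r = relax w s D p x σ in
    Improves S D σ (value r) × Relaxed (proj₁ (value r)) D x ×
    time r + Φ (proj₂ (value r)) ≤ 4 + C + Φ (proj₂ σ)
  relax-improves {D = D} inv D≡p (v , a) =
    let improves , reached , cost = update-improves inv (ℚₚ.<⇒≤ (<-+-w D (edge a))) (cong (ℚ._+ w (edge a)) D≡p) refl
    in improves , reached , s≤s (s≤s cost)

  relaxAll-improves : ∀ {S D σ u} {p : Walk s u} → Invariant S D σ → D ≡ weight p → (xs : List (∃[ v ] Arc u v)) →
    let r = forEach xs (relax w s D p) σ in
    Improves S D σ (value r) × All (Relaxed (proj₁ (value r)) D) xs ×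
    time r + Φ (proj₂ (value r)) ≤ length xs * (5 + C) + Φ (proj₂ σ)
  relaxAll-improves inv D≡p [] = improves-refl inv , [] , ≤-refl
  relaxAll-improves {S} {D} {σ} {u} {p} inv D≡p (x ∷ xs) =
    let first , relaxed , cost = relax-improves inv D≡p x
        rest , relaxeds , costs = relaxAll-improves (invariant first) D≡p xs
    -- The first arc stays relaxed because relaxing the others only lowers labels.
    in improves-trans first rest , lower rest relaxed ∷ relaxeds , total cost costs
    where
    total : ∀ {t φ t′ φ′ φ″} → t + φ′ ≤ 4 + C + φ → t′ + φ″ ≤ length xs * (5 + C) + φ′ →
      suc (t + t′) + φ″ ≤ 5 + C + length xs * (5 + C) + φ
    total {t} {φ} {t′} {φ′} {φ″} h₁ h₂ = begin
      suc (t + t′) + φ″                       ≡⟨ cong suc (+-assoc t t′ φ″) ⟩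
      suc (t + (t′ + φ″))                    ≤⟨ s≤s (+-monoʳ-≤ t h₂) ⟩
      suc (t + (length xs * (5 + C) + φ′))    ≡⟨ shuffle t (length xs * (5 + C)) φ′ ⟩
      suc (length xs * (5 + C)) + (t + φ′)    ≤⟨ +-monoʳ-≤ (suc (length xs * (5 + C))) h₁ ⟩
      suc (length xs * (5 + C)) + (4 + C + φ) ≡⟨ shuffle′ (length xs * (5 + C)) C φ ⟩
      5 + C + length xs * (5 + C) + φ         ∎
      where
      open ≤-Reasoning
      shuffle : ∀ t l φ → suc (t + (l + φ)) ≡ suc l + (t + φ)
      shuffle = solve-∀
      shuffle′ : ∀ l c φ → suc l + (4 + c + φ) ≡ 5 + c + l + φ
      shuffle′ = solve-∀

  -- Rounds of the main loop

  perRound perArc : ℕ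
  -- One `deleteMin`, one unit for its result, and two reads in `settle`.
  perRound = C * suc ⌊log₂ n ⌋ + 3
  perArc   = 5 + C

  Closed : (Fin n → Bool) → Labels → Set
  Closed S labels = ∀ {u d p v} → S u ≡ true → labels u ≡ just (d , p) → (a : Arc u v) → Relaxed labels d (v , a)

  -- Bellman's conditions: labels are weights of walks, the source has label at most 0, and no arc
  -- can lower a label. They force the labels to be the distances.
  record Final (labels : Labels) : Set where
    field
      source : Reached labels s 0ℚ
      weighs : ∀ {v d p} → labels v ≡ just (d , p) → d ≡ weight p
      closed : Closed (λ _ → true) labels

  settled⇒final : ∀ {S D labels heap} → Invariant S D (labels , heap) → Closed S labels → Reached labels s 0ℚ →
    (∀ {v d p} → labels v ≡ just (d , p) → S v ≡ true) → Final labels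
  settled⇒final inv closed source allSettled = record
    { source = source ; weighs = weighed inv ; closed = λ _ u↦ → closed (allSettled u↦) u↦ }

  -- The bound `D` rises to the extracted key `k`: older settled labels are below it since
  -- `D ℚ.≤ k`, and the remaining keys are above it since `k` was the minimum.
  extract : ∀ {S D labels heap heap′ u k p} → Invariant S D (labels , heap) → labels u ≡ just (k , p) → D ℚ.≤ k →
    (∀ j {l} → key heap j ≡ just l → k ℚ.≤ l) → key heap′ ≗ key heap [ u ≔ nothing ] →
    Invariant (S [ u ≔ true ]) k (labels , heap′)
  extract {S} {D} {labels} {heap} {heap′} {u} {k} {p} inv u↦ D≤k min key′ = record
    { keys = keys′ ; weighed = weighed inv ; settled≤ = settled≤′ ; ≤queued = ≤queued′ }
    where
    keys′ : ∀ v → key heap′ v ≡ (if (S [ u ≔ true ]) v then nothing else map proj₁ (labels v))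
    keys′ v with u ≟ v | key′ v
    ... | yes refl | key≡ = key≡
    ... | no  _    | key≡ = trans key≡ (keys inv v)

    settled≤′ : ∀ {v} → (S [ u ≔ true ]) v ≡ true → Reached labels v k
    settled≤′ {v} v∈S with u ≟ v
    ... | yes refl = k , p , u↦ , ℚₚ.≤-refl
    ... | no  _    = let d , q , v↦ , d≤D = settled≤ inv v∈S in d , q , v↦ , ℚₚ.≤-trans d≤D D≤k

    ≤queued′ : ∀ {v l} → key heap′ v ≡ just l → k ℚ.≤ l
    ≤queued′ {v} v↦ with u ≟ v | trans (sym (key′ v)) v↦
    ... | yes refl | ()
    ... | no  _    | key≡ = min v key≡

  -- Arcs from older settled vertices stay relaxed, as those labels are kept and all others only
  -- drop; arcs from `u` have just been relaxed, and `Complete` ensures that none was missed.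
  closed-extend : ∀ {S k u labels labels′ heap heap′ adj} {p : Walk s u} → Complete adj →
    Closed S labels → labels u ≡ just (k , p) →
    Improves (S [ u ≔ true ]) k (labels , heap) (labels′ , heap′) →
    All (Relaxed labels′ k) (adj u) → Closed (S [ u ≔ true ]) labels′
  closed-extend {S} {k} {u} {labels} {labels′} complete closed u↦ improves relaxed {x} x∈S′ x↦ a
    with u ≟ x | trans (sym (keep improves x∈S′)) x↦ | x∈S′
  ... | no _ | x↦₀ | x∈S = lower improves (closed x∈S x↦₀ a)
  ... | yes refl | x↦₀ | _ with trans (sym u↦) x↦₀
  ...   | refl = All.lookup relaxed (complete a)

  queued-labelled : ∀ {S D labels heap v k} → Invariant S D (labels , heap) → key heap v ≡ just k →
    S v ≡ false × ∃[ p ] labels v ≡ just (k , p)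
  queued-labelled {S} {labels = labels} {v = v} inv v∈heap with S v | labels v | trans (sym (keys inv v)) v∈heap
  ... | false | just (k , p) | refl = refl , p , refl

  -- The bounds are for `deleteMin`, the relaxations from one vertex of degree `x`, and the later
  -- rounds. The potentials between these phases telescope: they are added to both sides and
  -- cancelled.
  round-cost : ∀ {t c φ φ′ l x φ″ r k x′ y} →
    t + φ′ ≤ c + φ → l + φ″ ≤ x * y + φ′ → r ≤ k * (c + 3) + (x′ * y + φ″) →
    t + (1 + (2 + l + r)) ≤ suc k * (c + 3) + ((x + x′) * y + φ)
  round-cost {t} {c} {φ} {φ′} {l} {x} {φ″} {r} {k} {x′} {y} h₁ h₂ h₃ = +-cancelʳ-≤ (φ′ + φ″) _ _ (begin
    t + (1 + (2 + l + r)) + (φ′ + φ″)                                 ≡⟨ left t l r φ′ φ″ ⟩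
    3 + ((t + φ′) + ((l + φ″) + r))                                   ≤⟨ +-monoʳ-≤ 3 (+-mono-≤ h₁ (+-mono-≤ h₂ h₃)) ⟩
    3 + ((c + φ) + ((x * y + φ′) + (k * (c + 3) + (x′ * y + φ″))))    ≡⟨ right c φ x y φ′ k x′ φ″ ⟩
    suc k * (c + 3) + ((x + x′) * y + φ) + (φ′ + φ″)                  ∎)
    where
    open ≤-Reasoning
    left : ∀ t l r φ′ φ″ → t + (1 + (2 + l + r)) + (φ′ + φ″) ≡ 3 + ((t + φ′) + ((l + φ″) + r))
    left = solve-∀
    right : ∀ c φ x y φ′ k x′ φ″ →
      3 + ((c + φ) + ((x * y + φ′) + (k * (c + 3) + (x′ * y + φ″)))) ≡
      suc k * (c + 3) + ((x + x′) * y + φ) + (φ′ + φ″)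
    right = solve-∀

  -- Every round settles a vertex, so `k` bounds the number of unsettled ones. When it reaches 0 all
  -- vertices are settled; if the heap empties earlier, all labelled ones are, since a labelled
  -- unsettled vertex has a key.
  rounds-final : ∀ k adj {S D labels heap} → Complete adj →
    Invariant S D (labels , heap) → Closed S labels → Reached labels s 0ℚ → sum (pending S (λ _ → 1)) ≤ k →
    let r = rounds w s adj k (labels , heap) in
    Final (value r) × time r ≤ k * perRound + (sum (pending S (degree adj)) * perArc + Φ heap)
  rounds-final zero adj {S} complete inv closed source fuel = settled⇒final inv closed source (λ {v} _ → allSettled v) , z≤n
    where
    allSettled : ∀ v → S v ≡ true
    allSettled v with S v | ≤-trans (≤-sum (pending S (λ _ → 1)) v) fuel
    ... | true | _ = refl
  rounds-final (suc k) adj {S} {labels = labels} {heap} complete inv closed source fuel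
    with value (deleteMin heap) in min≡ | deleteMin-cost heap
  ... | nothing | cost = settled⇒final inv closed source allSettled , stop cost
    where
    -- `deleteMin` returned no heap, so the potential left over counts as 0; the 1 is the unit spent
    -- on its result.
    stop : ∀ {t φ r} → t + 0 ≤ C * suc ⌊log₂ n ⌋ + φ → t + 1 ≤ suc k * perRound + (r + φ)
    stop {t} {φ} {r} h = begin
      t + 1                              ≡⟨ left t ⟩
      1 + (t + 0)                        ≤⟨ +-monoʳ-≤ 1 h ⟩
      1 + (C * suc ⌊log₂ n ⌋ + φ)        ≤⟨ m≤m+n _ (2 + k * perRound + r) ⟩
      1 + (C * suc ⌊log₂ n ⌋ + φ) + (2 + k * perRound + r) ≡⟨ right (C * suc ⌊log₂ n ⌋) φ (k * perRound) r ⟩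
      suc k * perRound + (r + φ)         ∎
      where
      open ≤-Reasoning
      left : ∀ t → t + 1 ≡ 1 + (t + 0)
      left = solve-∀
      right : ∀ c φ k r → 1 + (c + φ) + (2 + k + r) ≡ (c + 3 + k) + (r + φ)
      right = solve-∀
    allSettled : ∀ {v d p} → labels v ≡ just (d , p) → S v ≡ true
    allSettled v↦ = ¬-not λ v∉S →
      contradiction (trans (sym (deleteMin-nothing heap min≡ _)) (queued inv v∉S v↦)) λ ()
  ... | just (u , heap′) | cost with deleteMin-just heap min≡
  ...   | (_ , u∈heap , min) , key′ with queued-labelled inv u∈heap
  ...     | u∉S , p , u↦
    -- The known label makes the lookup in `settle` compute, and the degree of `u` is split off to
    -- pay for its arcs.
    rewrite u↦ | sum-pending {S = S} (degree adj) u∉S =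
    let improves , relaxed , relaxCost =
          relaxAll-improves (extract inv u↦ (≤queued inv u∈heap) min key′) (weighed inv u↦) (adj u)
        fin , restCost =
          rounds-final k adj complete (invariant improves)
            (closed-extend {adj = adj} complete closed u↦ improves relaxed) (lower improves source)
            (≤-pred (subst (_≤ suc k) (sum-pending {S = S} (λ _ → 1) u∉S) fuel))
    in fin , round-cost {x = degree adj u} {k = k} cost relaxCost restCost

  -- Minimality of the final labels

  final-reached : ∀ {labels t} → Final labels → (q : Walk s t) → Reached labels t (weight q)
  final-reached fin []      = Final.source fin
  final-reached fin (q ▷ a) =
    let d , _ , u↦ , d≤q = final-reached fin q
        e , p , v↦ , e≤d = Final.closed fin refl u↦ a
    -- By induction along the walk, each relaxed arc passes the bound on to its head.
    in e , p , v↦ , ℚₚ.≤-trans e≤d (ℚₚ.+-monoˡ-≤ (w (edge a)) d≤q)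

  -- The given walk serves to show that `t` has a label at all. That label is the weight of the
  -- stored walk and bounds the weight of every walk from below.
  final-minimal : ∀ {labels t} → Final labels → Walk s t → ∃[ p ] map proj₂ (labels t) ≡ just p × Minimal p
  final-minimal {labels} fin q =
    let d , p , t↦ , _ = final-reached fin q
    in p , cong (map proj₂) t↦ , λ q′ → subst (ℚ._≤ weight q′) (Final.weighs fin t↦)
         (reached-unique labels t↦ (final-reached fin q′))

  -- Initial state and total running time

  adjacency : AdjacencyLists
  adjacency = value adjacencyLists

  emptyLabels startLabels : Labels
  emptyLabels = λ _ → nothing
  startLabels = emptyLabels [ s ≔ just (0ℚ , []) ]

  emptyHeap startHeap : Heap n
  emptyHeap = value (make n)
  startHeap = value (insert s 0ℚ emptyHeap)

  emptyInvariant : Invariant (λ _ → false) 0ℚ (emptyLabels , emptyHeap)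
  emptyInvariant = record
    { keys     = key-make n
    ; weighed  = λ ()
    ; settled≤ = λ ()
    ; ≤queued  = λ {v} v∈heap → contradiction (trans (sym (key-make n v)) v∈heap) λ ()
    }

  startInvariant : Invariant (λ _ → false) 0ℚ (startLabels , startHeap)
  startInvariant = invariant (relabel {v = s} {p = []} emptyInvariant refl ℚₚ.≤-refl refl (λ ())
    (key-insert emptyHeap s 0ℚ (key-make n s)))

  run : Final (value (rounds w s adjacency n (startLabels , startHeap))) ×
    time (rounds w s adjacency n (startLabels , startHeap)) ≤
      n * perRound + (sum (degree adjacency) * perArc + Φ startHeap)
  run = rounds-final n adjacency adjacency-complete startInvariant (λ ())
    (0ℚ , [] , ≔-same emptyLabels s , ℚₚ.≤-refl)
    (≤-reflexive (trans (sum-const n 1) (*-identityʳ n)))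

  dijkstra-minimal : ∀ {t} → Walk s t → ∃[ p ] value (dijkstra w s) t ≡ just p × Minimal p
  dijkstra-minimal = final-minimal (proj₁ run)

  -- The summands follow the steps of `dijkstra`: adjacency lists, label array, source label,
  -- `make`, `insert`, rounds and output. The potentials of the two initial heaps cancel.
  dijkstra-time : time (dijkstra w s) ≤ n + m * 5 + (n + (1 + (C * suc n + (C + (n * perRound + (m * 2 * perArc + n))))))
  dijkstra-time = begin
    time adjacencyLists + (n + (1 + (tm + (ti + (tr + n)))))
      ≡⟨ cong (_+ (n + (1 + (tm + (ti + (tr + n)))))) adjacencyLists-time ⟩
    n + m * 5 + (n + (1 + (tm + (ti + (tr + n)))))
      ≤⟨ +-monoʳ-≤ (n + m * 5) (+-monoʳ-≤ n (s≤s amortised)) ⟩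
    n + m * 5 + (n + (1 + (C * suc n + (C + (n * perRound + (m * 2 * perArc + n))))))  ∎
    where
    open ≤-Reasoning
    tm ti tr : ℕ
    tm = time (make n)
    ti = time (insert s 0ℚ emptyHeap)
    tr = time (rounds w s adjacency n (startLabels , startHeap))

    amortised : tm + (ti + (tr + n)) ≤ C * suc n + (C + (n * perRound + (m * 2 * perArc + n)))
    amortised = +-cancelʳ-≤ (Φ emptyHeap + Φ startHeap) _ _ (begin
      tm + (ti + (tr + n)) + (Φ emptyHeap + Φ startHeap)
        ≡⟨ left tm ti tr n (Φ emptyHeap) (Φ startHeap) ⟩
      (tm + Φ emptyHeap) + ((ti + Φ startHeap) + (tr + n))
        ≤⟨ +-mono-≤ (make-cost n) (+-mono-≤ (insert-cost emptyHeap s 0ℚ (key-make n s)) (+-monoˡ-≤ n (proj₂ run))) ⟩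
      C * suc n + ((C + Φ emptyHeap) + (n * perRound + (sum (degree adjacency) * perArc + Φ startHeap) + n))
        ≡⟨ cong (λ d → C * suc n + ((C + Φ emptyHeap) + (n * perRound + (d * perArc + Φ startHeap) + n))) sum-degree ⟩
      C * suc n + ((C + Φ emptyHeap) + (n * perRound + (m * 2 * perArc + Φ startHeap) + n))
        ≡⟨ right (C * suc n) C (Φ emptyHeap) (n * perRound) (m * 2 * perArc) (Φ startHeap) n ⟩
      C * suc n + (C + (n * perRound + (m * 2 * perArc + n))) + (Φ emptyHeap + Φ startHeap) ∎)
      where
      left : ∀ x y z n a b → x + (y + (z + n)) + (a + b) ≡ (x + a) + ((y + b) + (z + n))
      left = solve-∀
      right : ∀ x c a y z b n → x + ((c + a) + (y + (z + b) + n)) ≡ x + (c + (y + (z + n))) + (a + b)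
      right = solve-∀

  -- For `2 ≤ n` the logarithm is at least 1, so linear and constant terms are absorbed by
  -- `n * ⌊log₂ n ⌋`.
  dijkstra-time-log : 2 ≤ n → time (dijkstra w s) ≤ (15 + 5 * C) * (m + n * ⌊log₂ n ⌋)
  dijkstra-time-log 2≤n = begin
    time (dijkstra w s)
      ≤⟨ dijkstra-time ⟩
    n + m * 5 + (n + (1 + (C * suc n + (C + (n * (C * suc l + 3) + (m * 2 * (5 + C) + n))))))
      ≡⟨ collect n m C l ⟩
    m * (15 + 2 * C) + (1 + 2 * C + (n * (6 + 2 * C) + n * l * C))
      ≤⟨ +-monoʳ-≤ (m * (15 + 2 * C)) (+-mono-≤ constant (+-monoˡ-≤ (n * l * C) (*-monoˡ-≤ (6 + 2 * C) n≤nl))) ⟩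
    m * (15 + 2 * C) + (n * l * (1 + 2 * C) + (n * l * (6 + 2 * C) + n * l * C))
      -- The coefficients are now `15 + 2 * C` for `m` and `7 + 5 * C` for `n * l`; the slack raises
      -- both to `15 + 5 * C`.
      ≤⟨ m≤m+n _ (m * (3 * C) + n * l * 8) ⟩
    m * (15 + 2 * C) + (n * l * (1 + 2 * C) + (n * l * (6 + 2 * C) + n * l * C)) + (m * (3 * C) + n * l * 8)
      ≡⟨ combine m (n * l) C ⟩
    (15 + 5 * C) * (m + n * l) ∎
    where
    open ≤-Reasoning
    l : ℕ
    l = ⌊log₂ n ⌋
    n≤nl : n ≤ n * l
    n≤nl = subst (_≤ n * l) (*-identityʳ n) (*-monoʳ-≤ n (⌊log₂⌋-mono-≤ 2≤n))
    constant : 1 + 2 * C ≤ n * l * (1 + 2 * C)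
    constant = subst (_≤ n * l * (1 + 2 * C)) (*-identityˡ _)
      (*-monoˡ-≤ (1 + 2 * C) (≤-trans (≤-trans (s≤s z≤n) 2≤n) n≤nl))
    collect : ∀ n m c l →
      n + m * 5 + (n + (1 + (c * suc n + (c + (n * (c * suc l + 3) + (m * 2 * (5 + c) + n)))))) ≡
      m * (15 + 2 * c) + (1 + 2 * c + (n * (6 + 2 * c) + n * l * c))
    collect = solve-∀
    combine : ∀ m x c →
      m * (15 + 2 * c) + (x * (1 + 2 * c) + (x * (6 + 2 * c) + x * c)) + (m * (3 * c) + x * 8) ≡
      (15 + 5 * c) * (m + x)
    combine = solve-∀

-- Weights 1 and 1 + 1/g

-- All weights get the common denominator `g`, which reduces their comparison to natural numbers.
fraction : (g : ℕ) .{{_ : NonZero g}} → ℕ → ℚ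
fraction g k = ℤ.+ k ℚ./ g

-- `ℚ./` reduces to lowest terms; among unnormalised rationals the denominator `g` remains visible
-- and cross-multiplication applies.
toℚᵘ-fraction : ∀ g-1 k → ℚ.toℚᵘ (fraction (suc g-1) k) ℚᵘ.≃ ℚᵘ.mkℚᵘ (ℤ.+ k) g-1
toℚᵘ-fraction g-1 k = ℚₚ.toℚᵘ-fromℚᵘ (ℚᵘ.mkℚᵘ (ℤ.+ k) g-1)

fraction-+ : ∀ g .{{_ : NonZero g}} a b → fraction g (a + b) ≡ fraction g a ℚ.+ fraction g b
fraction-+ g@(suc g-1) a b = ℚₚ.toℚᵘ-injective (begin
  ℚ.toℚᵘ (fraction g (a + b))                         ≈⟨ toℚᵘ-fraction g-1 (a + b) ⟩
  ℚᵘ.mkℚᵘ (ℤ.+ (a + b)) g-1                           ≈⟨ ℚᵘ.*≡* (trans (cong ((ℤ.+ a ℤ.+ ℤ.+ b) ℤ.*_) (ℤₚ.pos-* g g))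
                                                           (shuffle (ℤ.+ a) (ℤ.+ b) (ℤ.+ g))) ⟩
  ℚᵘ.mkℚᵘ (ℤ.+ a) g-1 ℚᵘ.+ ℚᵘ.mkℚᵘ (ℤ.+ b) g-1        ≈⟨ ℚᵘₚ.+-cong (toℚᵘ-fraction g-1 a) (toℚᵘ-fraction g-1 b) ⟨
  ℚ.toℚᵘ (fraction g a) ℚᵘ.+ ℚ.toℚᵘ (fraction g b)    ≈⟨ ℚₚ.toℚᵘ-homo-+ (fraction g a) (fraction g b) ⟨
  ℚ.toℚᵘ (fraction g a ℚ.+ fraction g b)              ∎)
  where
  open ℚᵘₚ.≃-Reasoning
  shuffle : ∀ a b g → (a ℤ.+ b) ℤ.* (g ℤ.* g) ≡ (a ℤ.* g ℤ.+ b ℤ.* g) ℤ.* g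
  shuffle = ℤ-solve-∀

fraction-cancel-≤ : ∀ g .{{_ : NonZero g}} {a b} → fraction g a ℚ.≤ fraction g b → a ≤ b
fraction-cancel-≤ g@(suc g-1) {a} {b} a≤b = ℤₚ.drop‿+≤+
  (ℤₚ.*-cancelʳ-≤-pos (ℤ.+ a) (ℤ.+ b) (ℤ.+ g) (ℚᵘₚ.drop-*≤* (begin
    ℚᵘ.mkℚᵘ (ℤ.+ a) g-1      ≃⟨ toℚᵘ-fraction g-1 a ⟨
    ℚ.toℚᵘ (fraction g a)    ≤⟨ ℚₚ.toℚᵘ-mono-≤ a≤b ⟩
    ℚ.toℚᵘ (fraction g b)    ≃⟨ toℚᵘ-fraction g-1 b ⟩
    ℚᵘ.mkℚᵘ (ℤ.+ b) g-1      ∎)))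
  where open ℚᵘₚ.≤-Reasoning

fraction-0 : ∀ g .{{_ : NonZero g}} → fraction g 0 ≡ 0ℚ
fraction-0 g = ℚₚ.0/n≡0 g

fraction-self : ∀ g .{{_ : NonZero g}} → fraction g g ≡ 1ℚ
fraction-self g@(suc g-1) = ℚₚ.toℚᵘ-injective (ℚᵘₚ.≃-trans (toℚᵘ-fraction g-1 g)
  (ℚᵘ.*≡* (ℤₚ.*-comm (ℤ.+ g) (ℤ.+ 1))))

module _ {m : ℕ} (Eg : Subset m) (g : ℕ) .{{_ : NonZero g}} where

  grayWeight-fraction : ∀ e → grayWeight Eg g e ≡ fraction g (g + (if does (e ∈? Eg) then 1 else 0))
  grayWeight-fraction e with does (e ∈? Eg)
  ... | true  = sym (trans (fraction-+ g g 1) (cong (ℚ._+ fraction g 1) (fraction-self g)))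
  ... | false = sym (trans (cong (fraction g) (+-identityʳ g)) (fraction-self g))

  grayWeight-positive : ∀ e → 0ℚ ℚ.< grayWeight Eg g e
  grayWeight-positive e = ℚₚ.≰⇒> λ w≤0 → <⇒≱ (>-nonZero⁻¹ g) (≤-trans (m≤m+n g _)
    (fraction-cancel-≤ g (subst₂ ℚ._≤_ (grayWeight-fraction e) (sym (fraction-0 g)) w≤0)))

-- From minimal weight to few edges and few gray edges

module WeakCSSSP {n m : ℕ} (G : Graph n m) (Eg : Subset m) (g : ℕ) .{{_ : NonZero g}} where
  open Walks G
  open Weighted G (grayWeight Eg g) (grayWeight-positive Eg g)

  weight-fraction : ∀ {u v} (p : Walk u v) → weight p ≡ fraction g (g * ∣ p ∣ + gray Eg p)
  weight-fraction []      = sym (trans (cong (λ k → fraction g (k + 0)) (*-zeroʳ g)) (fraction-0 g))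
  weight-fraction (p ▷ a) = begin
    weight p ℚ.+ grayWeight Eg g (edge a)
      ≡⟨ cong₂ ℚ._+_ (weight-fraction p) (grayWeight-fraction Eg g (edge a)) ⟩
    fraction g (g * ∣ p ∣ + gray Eg p) ℚ.+ fraction g (g + b)
      ≡⟨ fraction-+ g (g * ∣ p ∣ + gray Eg p) (g + b) ⟨
    fraction g (g * ∣ p ∣ + gray Eg p + (g + b))
      ≡⟨ cong (fraction g) (shuffle g ∣ p ∣ (gray Eg p) b) ⟩
    fraction g (g * suc ∣ p ∣ + (b + gray Eg p)) ∎
    where
    open ≡-Reasoning
    b : ℕ
    b = if does (edge a ∈? Eg) then 1 else 0
    shuffle : ∀ g l r b → g * l + r + (g + b) ≡ g * suc l + (b + r)
    shuffle = solve-∀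

  minimal-scaled : ∀ {u v} (p : Walk u v) → Minimal p → ∀ q → g * ∣ p ∣ + gray Eg p ≤ g * ∣ q ∣ + gray Eg q
  minimal-scaled p min q =
    fraction-cancel-≤ g (subst₂ ℚ._≤_ (weight-fraction p) (weight-fraction q) (min q))

  -- The surcharge for the gray edges of `q` adds up to less than one whole edge.
  minimal-< : ∀ {u v} (p : Walk u v) → Minimal p → ∀ q → gray Eg q < g → g * ∣ p ∣ + gray Eg p < g * suc ∣ q ∣
  minimal-< p min q q<g = begin-strict
    g * ∣ p ∣ + gray Eg p  ≤⟨ minimal-scaled p min q ⟩
    g * ∣ q ∣ + gray Eg q  <⟨ +-monoʳ-< (g * ∣ q ∣) q<g ⟩
    g * ∣ q ∣ + g          ≡⟨ trans (+-comm (g * ∣ q ∣) g) (sym (*-suc g ∣ q ∣)) ⟩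
    g * suc ∣ q ∣          ∎
    where open ≤-Reasoning

  minimal-length : ∀ {u v} (p : Walk u v) → Minimal p → ∀ q → gray Eg q < g → ∣ p ∣ ≤ ∣ q ∣
  minimal-length p min q q<g =
    ≤-pred (*-cancelˡ-< g ∣ p ∣ (suc ∣ q ∣) (≤-<-trans (m≤m+n (g * ∣ p ∣) (gray Eg p)) (minimal-< p min q q<g)))

  flip : ∀ {u v} → Arc u v → Arc v u
  flip (e along j) = e along swap j

  ∣++∣ : ∀ {u v x} (p : Walk u v) (q : Walk v x) → ∣ p ++ q ∣ ≡ ∣ p ∣ + ∣ q ∣
  ∣++∣ p []      = sym (+-identityʳ _)
  ∣++∣ p (q ▷ _) = trans (cong suc (∣++∣ p q)) (sym (+-suc ∣ p ∣ ∣ q ∣))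

  -- Going back along the first arc of q, along p and back along its last arc competes with the middle part of q.
  gshort-length : ∀ {s t} {q : Walk s t} → GShort Eg g q → (p : Walk s t) → ∣ q ∣ ≤ 4 + ∣ p ∣
  gshort-length (_ , _ , _ , a , π , b , shortest , refl) p = s≤s (begin
    ∣ ([] ▷ a) ++ π ∣                   ≡⟨ ∣++∣ ([] ▷ a) π ⟩
    -- The two reversed arcs of this competitor, together with the end arcs `a` and `b` of `q`, make
    -- up the 4.
    1 + ∣ π ∣                           ≤⟨ s≤s (shortest (([] ▷ flip a) ++ p ▷ flip b)) ⟩
    2 + ∣ ([] ▷ flip a) ++ p ∣          ≡⟨ cong (2 +_) (∣++∣ ([] ▷ flip a) p) ⟩
    3 + ∣ p ∣                           ∎)
    where open ≤-Reasoning

  minimal-gray : ∀ {s t} (p : Walk s t) {q} → Minimal p → GShort Eg g q → gray Eg p ≤ 5 * g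
  minimal-gray p {q} min short@(q<g , _) = <⇒≤ (+-cancelˡ-< (g * ∣ p ∣) _ _ (begin-strict
    g * ∣ p ∣ + gray Eg p   <⟨ minimal-< p min q q<g ⟩
    -- Four edges from g-shortness and one from the gray edges of `q` give the factor 5.
    g * suc ∣ q ∣           ≤⟨ *-monoʳ-≤ g (s≤s (gshort-length short p)) ⟩
    g * (5 + ∣ p ∣)         ≡⟨ expand g ∣ p ∣ ⟩
    g * ∣ p ∣ + 5 * g       ∎))
    where
    open ≤-Reasoning
    expand : ∀ g l → g * (5 + l) ≡ g * l + 5 * g
    expand = solve-∀

theorem4 : (H : FibonacciHeap) →
    (∃[ c ] ∃[ n₀ ] ∀ {n m} (G : Graph n m) (Eg : Subset m) (s : Fin n) (g : ℕ) .{{_ : NonZero g}} →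
    n₀ ≤ n → time (weakCSSSP H G Eg s g) ≤ c * (m + n * ⌊log₂ n ⌋)) ×
    (∀ {n m} (G : Graph n m) (Eg : Subset m) (s : Fin n) (g : ℕ) .{{_ : NonZero g}} →
    Walks.SolvesWeakCSSSP G Eg s g (value (weakCSSSP H G Eg s g)))
theorem4 H =
  (15 + 5 * FibonacciHeap.C H , 2 , λ G Eg s g →
    Dijkstra.dijkstra-time-log H G (grayWeight Eg g) (grayWeight-positive Eg g) s) ,
  -- The g-short walk `q` also witnesses that `t` is reachable, so a walk is returned.
  λ G Eg s g t (q , short) →
    let open WeakCSSSP G Eg g
        p , found , min = Dijkstra.dijkstra-minimal H G (grayWeight Eg g) (grayWeight-positive Eg g) s q
    in p , found ,
       Weighted.minimal⇒simple G (grayWeight Eg g) (grayWeight-positive Eg g) p min ,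
       minimal-gray p min short ,
       minimal-length p min
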